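{- For all integers $k \ge 0$ it holds that $S_2(k) = 2 \cdot a_2(k)$.
   Context: For an integer $k \ge 0$, $S_2(k)$ denotes the smallest integer $n \ge 0$ such that $2^k$ divides $n!$, except that by convention $S_2(0) = 0$ (equivalently, $S_2(k)$ is the smallest integer $n \ge 0$ with $k \le \sum_{i=1}^n \mathrm{ord}_2(i)$, where $\mathrm{ord}_2(i)$ is the largest $m \ge 0$ such that $2^m$ divides $i$). The sequence $a_2 : \mathbb{N}_0 \to \mathbb{N}_0$ is defined by $a_2(0) = 0$, $a_2(1) = 1$, and for $k \ge 2$ by the nested recursion $a_2(k) = a_2(k - a_2(k-1)) + a_2(k - 1 - a_2(k-2))$. Here $\mathbb{N}_0 = \{0,1,2,\dots\}$. -}

module Defs where

open import Data.Nat
open import Data.Nat.Properties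
open import Data.Nat.Divisibility using (_∣_; _∣?_; ∣-refl; m∣m*n)
open import Data.Product using (∃; _×_; _,_; proj₁; proj₂)
open import Data.Sum using (_⊎_; inj₁; inj₂)
open import Function using (_∘_)
open import Level using (Level)
open import Relation.Binary.PropositionalEquality
open import Relation.Nullary using (yes; no; contradiction)
open import Relation.Unary using (Pred; Decidable)

private
  variable
    ℓ : Level

IsLeast : Pred ℕ ℓ → Pred ℕ ℓ
IsLeast P n = P n × (∀ m → P m → n ≤ m)

least : {P : Pred ℕ ℓ} → Decidable P → ∀ n → P n → ∃ (IsLeast P)
least P? zero    p = 0 , p , λ _ _ → z≤n
least {P = P} P? (suc n) p with P? 0
... | yes p₀ = 0 , p₀ , λ _ _ → z≤n
... | no ¬p₀ with least (P? ∘ suc) n p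
...   | k , pk , min = suc k , pk , min′
  where
  min′ : ∀ m → P m → suc k ≤ m
  min′ zero    q = contradiction q ¬p₀
  min′ (suc m) q = s≤s (min m q)

n∣n! : ∀ n → .{{NonZero n}} → n ∣ n !
n∣n! (suc n) = m∣m*n (n !)

-- The witness 2 ^ k only serves to bound the search.
S₂-search : ∀ k → ∃ (IsLeast (λ n → 2 ^ k ∣ n !))
S₂-search k = least (λ n → 2 ^ k ∣? n !) (2 ^ k) (n∣n! (2 ^ k) {{m^n≢0 2 k}})

S₂ : ℕ → ℕ
S₂ zero      = 0
S₂ k@(suc _) = proj₁ (S₂-search k)

-- The convention S₂ 0 = 0 agrees with the general rule, since 1 ∣ 0 !.
S₂-isLeast : ∀ k → IsLeast (λ n → 2 ^ k ∣ n !) (S₂ k)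
S₂-isLeast zero      = ∣-refl , λ _ _ → z≤n
S₂-isLeast k@(suc _) = proj₂ (S₂-search k)

-- The nested recursion is not structural, so it is run with a bound on the
-- recursion depth; depth suc k suffices at k, and the value returned at
-- depth 0 is never used. By a₂-rec and a₂[k]≤k below, a₂ satisfies the
-- defining recursion, with no truncation in the subtractions.
a₂-depth : ℕ → ℕ → ℕ
a₂-depth zero    _             = 0
a₂-depth (suc d) zero          = 0
a₂-depth (suc d) (suc zero)    = 1
a₂-depth (suc d) (suc (suc k)) =
  a₂-depth d (2 + k ∸ a₂-depth d (1 + k)) + a₂-depth d (1 + k ∸ a₂-depth d k)

a₂ : ℕ → ℕ
a₂ k = a₂-depth (suc k) k

private
  Step : ℕ → Set
  Step k = a₂ (suc k) ≡ a₂ k ⊎ a₂ (suc k) ≡ suc (a₂ k)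

  Rec : ℕ → Set
  Rec k = a₂ (2 + k) ≡ a₂ (2 + k ∸ a₂ (1 + k)) + a₂ (1 + k ∸ a₂ k)

  -- Rec k reads a₂ (2 + k) ≡ a₂ (arg (1 + k)) + a₂ (arg k).
  arg : ℕ → ℕ
  arg k = suc k ∸ a₂ k

  record Good (n : ℕ) : Set where
    field
      stable : ∀ k → k ≤ n → ∀ d → k < d → a₂-depth d k ≡ a₂ k
      step   : ∀ k → k < n → Step k
      rec    : ∀ k → 2 + k ≤ n → Rec k

    bound : ∀ k → k ≤ n → a₂ k ≤ k
    bound zero    _   = z≤n
    bound (suc k) k<n with step k k<n
    ... | inj₁ e rewrite e = m≤n⇒m≤1+n (bound k (<⇒≤ k<n))
    ... | inj₂ e rewrite e = s≤s (bound k (<⇒≤ k<n))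

    positive : ∀ k → suc k ≤ n → 1 ≤ a₂ (suc k)
    positive zero    _ = ≤-refl
    positive (suc k) h with step (suc k) h
    ... | inj₁ e rewrite e = positive k (<⇒≤ h)
    ... | inj₂ e rewrite e = s≤s z≤n

    mono : ∀ k → k < n → a₂ k ≤ a₂ (suc k)
    mono k h with step k h
    ... | inj₁ e = ≤-reflexive (sym e)
    ... | inj₂ e = ≤-trans (n≤1+n _) (≤-reflexive (sym e))

    shift : ∀ k → k < n →
            arg (suc k) ≡ arg k
          ⊎ (arg (suc k) ≡ suc (arg k) × a₂ (suc k) ≡ a₂ k)
    shift k h with step k h
    ... | inj₁ e =
      inj₂ (trans (cong (2 + k ∸_) e)
                  (+-∸-assoc 1 (m≤n⇒m≤1+n (bound k (<⇒≤ h)))) , e)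
    ... | inj₂ e = inj₁ (cong (2 + k ∸_) e)

    arg≤ : ∀ k → 1 + k ≤ n → arg (1 + k) ≤ 1 + k
    arg≤ k h = ∸-monoʳ-≤ (2 + k) (positive k h)

  open Good

  -- If a₂ is constant on m, 1 + m, 2 + m, then it is constant on the
  -- last two arguments used.
  flat : ∀ m → Good (2 + m) → arg (1 + m) ≡ suc (arg m) →
         a₂ (1 + m) ≡ a₂ m → a₂ (2 + m) ≡ a₂ (1 + m) →
         a₂ (arg (1 + m)) ≡ a₂ (arg m)
  flat zero    G v≡ () e₁
  flat (suc j) G v≡ e₀ e₁ = by (shift G j (m≤n+m (suc j) 2))
    where
    t = arg j
    w = arg (1 + j)
    v = arg (2 + j)
    v≡t : a₂ v ≡ a₂ t
    v≡t = +-cancelʳ-≡ (a₂ w) (a₂ v) (a₂ t) (begin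
      a₂ v + a₂ w  ≡⟨ rec G (1 + j) ≤-refl ⟨
      a₂ (3 + j)   ≡⟨ e₁ ⟩
      a₂ (2 + j)   ≡⟨ rec G j (n≤1+n _) ⟩
      a₂ w + a₂ t  ≡⟨ +-comm (a₂ w) (a₂ t) ⟩
      a₂ t + a₂ w  ∎)
      where open ≡-Reasoning
    w<3+j : w < 3 + j
    w<3+j = s≤s (m≤n⇒m≤1+n (arg≤ G j (m≤n+m (1 + j) 2)))
    by : w ≡ t ⊎ (w ≡ suc t × a₂ (suc j) ≡ a₂ j) → a₂ v ≡ a₂ w
    by (inj₁ w≡t) = trans v≡t (cong a₂ (sym w≡t))
    by (inj₂ (w≡ , _)) = ≤-antisym
      (subst₂ _≤_ (sym v≡t) (cong a₂ (sym w≡))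
        (mono G t (≤-trans (≤-reflexive (sym w≡)) (<⇒≤ w<3+j))))
      (subst (a₂ w ≤_) (cong a₂ (sym v≡)) (mono G w w<3+j))

  -- a₂ (1 + n) and a₂ (2 + n) share a summand of the recursion, and their
  -- other summands are values of a₂ at arguments at most two apart.
  step-next : ∀ n → Good (suc n) → Rec n → Step (suc n)
  step-next zero    _ _ = inj₂ refl
  step-next (suc m) G r =
    subst₂ (λ p q → q ≡ p ⊎ q ≡ suc p) (sym r′) (sym r)
           (lift (main (shift G (1 + m) ≤-refl) (shift G m (n≤1+n _))))
    where
    u = arg (2 + m)
    v = arg (1 + m)
    w = arg m
    r′ : a₂ (2 + m) ≡ a₂ w + a₂ v
    r′ = trans (rec G m ≤-refl) (+-comm (a₂ v) (a₂ w))
    lift : a₂ u ≡ a₂ w ⊎ a₂ u ≡ suc (a₂ w) →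
           a₂ u + a₂ v ≡ a₂ w + a₂ v ⊎ a₂ u + a₂ v ≡ suc (a₂ w + a₂ v)
    lift (inj₁ e) = inj₁ (cong (_+ a₂ v) e)
    lift (inj₂ e) = inj₂ (cong (_+ a₂ v) e)
    v<2+m : v < 2 + m
    v<2+m = s≤s (arg≤ G m (n≤1+n _))
    from : ∀ {p} i → u ≡ suc i → a₂ i ≡ p → i < 2 + m →
           a₂ u ≡ p ⊎ a₂ u ≡ suc p
    from i u≡ refl i<2+m rewrite u≡ = step G i i<2+m
    main : u ≡ v ⊎ (u ≡ suc v × a₂ (2 + m) ≡ a₂ (1 + m)) →
           v ≡ w ⊎ (v ≡ suc w × a₂ (1 + m) ≡ a₂ m) →
           a₂ u ≡ a₂ w ⊎ a₂ u ≡ suc (a₂ w)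
    main (inj₁ u≡v) (inj₁ v≡w) = inj₁ (cong a₂ (trans u≡v v≡w))
    main (inj₁ u≡v) (inj₂ (v≡ , _)) =
      from w (trans u≡v v≡) refl (<-trans (≤-reflexive (sym v≡)) v<2+m)
    main (inj₂ (u≡ , _)) (inj₁ v≡w) = from v u≡ (cong a₂ v≡w) v<2+m
    main (inj₂ (u≡ , e₁)) (inj₂ (v≡ , e₀)) =
      from v u≡ (flat m G v≡ e₀ e₁) v<2+m

  stable-next : ∀ n → Good (suc n) → ∀ d → suc n < d →
    a₂-depth (suc d) (2 + n) ≡ a₂ (arg (1 + n)) + a₂ (arg n)
  stable-next n G d n<d
    rewrite stable G (1 + n) ≤-refl d n<d
          | stable G n (n≤1+n n) d (<⇒≤ n<d)
          = cong₂ _+_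
              (stable G (arg (1 + n)) p d (≤-<-trans p n<d))
              (stable G (arg n) q d (≤-<-trans q n<d))
    where
    p = arg≤ G n ≤-refl
    q = m∸n≤m (1 + n) (a₂ n)

  good : ∀ n → Good (suc n)
  good zero = record
    { stable = λ { zero       _         (suc _) _ → refl
                 ; (suc zero) _         (suc _) _ → refl
                 ; (suc (suc _)) (s≤s ()) }
    ; step   = λ { zero _ → inj₂ refl ; (suc _) (s≤s ()) }
    ; rec    = λ { _ (s≤s ()) }
    }
  good (suc n) = record { stable = stable′ ; step = step′ ; rec = rec′ }
    where
    G = good n
    r : Rec n
    r = stable-next n G (2 + n) ≤-refl
    stable′ : ∀ k → k ≤ 2 + n → ∀ d → k < d → a₂-depth d k ≡ a₂ k
    stable′ k k≤ d k<d with m≤n⇒m<n∨m≡n k≤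
    ... | inj₁ (s≤s k≤′) = stable G k k≤′ d k<d
    stable′ k k≤ (suc d) (s≤s k≤d) | inj₂ refl =
      trans (stable-next n G d k≤d) (sym r)
    step′ : ∀ k → k < 2 + n → Step k
    step′ k (s≤s k≤) with m≤n⇒m<n∨m≡n k≤
    ... | inj₁ k<  = step G k k<
    ... | inj₂ refl = step-next n G r
    rec′ : ∀ k → 2 + k ≤ 2 + n → Rec k
    rec′ k (s≤s (s≤s k≤)) with m≤n⇒m<n∨m≡n k≤
    ... | inj₁ k<  = rec G k (s≤s k<)
    ... | inj₂ refl = r

a₂[k]≤k : ∀ k → a₂ k ≤ k
a₂[k]≤k k = bound (good k) k (n≤1+n k)

a₂-rec : ∀ k → a₂ (2 + k) ≡ a₂ (2 + k ∸ a₂ (1 + k)) + a₂ (1 + k ∸ a₂ k)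
a₂-rec k = rec (good (1 + k)) k ≤-refl

{-# OPTIONS --safe #-}

-- Put F n = ord₂ (n !) and E m = F (2 * m). Legendre's formula
-- E m = m + F m makes E strictly increasing, and F (1 + 2n) = F (2n) = E n.
-- Let T k be the least m with k ≤ E m, so that S₂ k = 2 * T k. Comparing T k
-- with 2n shows that 1 + k ∸ T k ≤ E n exactly when 1 + k ≤ E (2n), and hence
-- T (1 + k ∸ T k) = ⌈ T (1 + k) / 2 ⌉. The recursion for T thus amounts to
-- T (2 + k) = ⌈ T (2 + k) / 2 ⌉ + ⌈ T (1 + k) / 2 ⌉, which holds because T
-- grows by at most one and never repeats an odd value.
module Submission where

open import Defs using (S₂; a₂; IsLeast; least; S₂-isLeast; a₂-rec)
open import Data.Nat
  using (ℕ; zero; suc; _+_; _*_; _∸_; _^_; _!; _≤_; _<_; z≤n; s≤s; NonZero; ⌊_/2⌋; ⌈_/2⌉; _≤?_)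
open import Data.Nat.Divisibility
  using (_∣_; ∣-trans; m∣m*n; *-cancelˡ-∣; m≤n⇒m!∣n!; ∣1⇒≡1; ∣m+n∣m⇒∣n)
open import Data.Nat.Induction using (<-rec)
open import Data.Nat.Properties
open import Data.Nat.Tactic.RingSolver using (solve-∀)
open import Data.Product using (∃; _,_; proj₁; proj₂)
open import Data.Sum using (_⊎_; inj₁; inj₂)
open import Level using (Level)
open import Relation.Binary.Definitions using (tri<; tri≈; tri>)
open import Relation.Binary.PropositionalEquality
  using (_≡_; refl; sym; trans; cong; cong₂; subst; subst₂; module ≡-Reasoning)
open import Relation.Nullary using (yes; no; contradiction)
open import Relation.Unary using (Pred)

private
  variable
    ℓ : Level
    d e k m n : ℕ

-- Least elements, parity and halving.

isLeast-unique : {P : Pred ℕ ℓ} → IsLeast P m → IsLeast P n → m ≡ n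
isLeast-unique (pm , m≤) (pn , n≤) = ≤-antisym (m≤ _ pn) (n≤ _ pm)

parity : ∀ n → ∃ λ h → n ≡ 2 * h ⊎ n ≡ 1 + 2 * h
parity zero = 0 , inj₁ refl
parity (suc n) with parity n
... | h , inj₁ refl = h , inj₂ refl
... | h , inj₂ refl = suc h , inj₁ (sym (*-suc 2 h))

⌈n/2⌉≤m⇒n≤2*m : ∀ n {m} → ⌈ n /2⌉ ≤ m → n ≤ 2 * m
⌈n/2⌉≤m⇒n≤2*m n {m} h = begin
  n                   ≡⟨ ⌊n/2⌋+⌈n/2⌉≡n n ⟨
  ⌊ n /2⌋ + ⌈ n /2⌉   ≤⟨ +-mono-≤ (≤-trans (⌊n/2⌋≤⌈n/2⌉ n) h) h ⟩
  m + m               ≡⟨ cong (m +_) (+-identityʳ m) ⟨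
  2 * m               ∎
  where open ≤-Reasoning

⌈2*n/2⌉≡n : ∀ n → ⌈ 2 * n /2⌉ ≡ n
⌈2*n/2⌉≡n n = trans (cong (λ x → ⌈ n + x /2⌉) (+-identityʳ n)) (sym (n≡⌈n+n/2⌉ n))

n≤2*m⇒⌈n/2⌉≤m : n ≤ 2 * m → ⌈ n /2⌉ ≤ m
n≤2*m⇒⌈n/2⌉≤m {m = m} h = ≤-trans (⌈n/2⌉-mono h) (≤-reflexive (⌈2*n/2⌉≡n m))

-- The 2-adic valuation.

-- Valuation e n says that ord₂ n = e.
record Valuation (e n : ℕ) : Set where
  constructor odd-cofactor
  field
    q  : ℕ
    n≡ : n ≡ 2 ^ e * (1 + 2 * q)

2^-mono-∣ : d ≤ e → 2 ^ d ∣ 2 ^ e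
2^-mono-∣ {d} {e} d≤e =
  subst (λ x → 2 ^ d ∣ 2 ^ x) (m+[n∸m]≡n d≤e)
    (subst (2 ^ d ∣_) (sym (^-distribˡ-+-* 2 d (e ∸ d))) (m∣m*n _))

valuation-≤⇒∣ : Valuation e n → k ≤ e → 2 ^ k ∣ n
valuation-≤⇒∣ (odd-cofactor _ refl) k≤e = ∣-trans (2^-mono-∣ k≤e) (m∣m*n _)

-- If `k` exceeded `e`, then `2 ^ e * 2` would divide `n`; cancelling `2 ^ e` would make 2 divide
-- `1 + 2 * q`, hence 1.
valuation-∣⇒≤ : Valuation e n → 2 ^ k ∣ n → k ≤ e
valuation-∣⇒≤ {e} {k = k} (odd-cofactor q refl) 2^k∣n with k ≤? e
... | yes k≤e = k≤e
... | no  k≰e = contradiction (∣1⇒≡1 2∣1) λ ()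
  where
  2^e*2∣ : 2 ^ e * 2 ∣ 2 ^ e * (1 + 2 * q)
  2^e*2∣ = subst (_∣ 2 ^ e * (1 + 2 * q)) (*-comm 2 (2 ^ e))
             (∣-trans (2^-mono-∣ (≰⇒> k≰e)) 2^k∣n)
  2∣1 : 2 ∣ 1
  2∣1 = ∣m+n∣m⇒∣n
    (subst (2 ∣_) (+-comm 1 (2 * q)) (*-cancelˡ-∣ (2 ^ e) {{m^n≢0 2 e}} 2^e*2∣))
    (m∣m*n q)

valuation-unique : Valuation d n → Valuation e n → d ≡ e
valuation-unique v w =
  ≤-antisym (valuation-∣⇒≤ w (valuation-≤⇒∣ v ≤-refl))
            (valuation-∣⇒≤ v (valuation-≤⇒∣ w ≤-refl))

valuation : ∀ n → .{{NonZero n}} → ∃ λ e → Valuation e n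
valuation = <-rec (λ n → .{{NonZero n}} → ∃ λ e → Valuation e n) go
  where
  go : ∀ n → (∀ {m} → m < n → .{{NonZero m}} → ∃ λ e → Valuation e m) →
       .{{NonZero n}} → ∃ λ e → Valuation e n
  go n rec with parity n
  ... | h , inj₂ n≡ = 0 , odd-cofactor h (trans n≡ (sym (*-identityˡ _)))
  ... | suc h , inj₁ refl with rec (m<m+n (suc h) (s≤s z≤n))
  ...   | e , odd-cofactor q h≡ =
    suc e , odd-cofactor q (trans (cong (2 *_) h≡) (sym (*-assoc 2 (2 ^ e) (1 + 2 * q))))

-- Legendre's formula for factorials.

-- F and the proofs of its two recursion formulas are opaque: normalising them
-- during with-abstraction exhausts the memory of the type checker.
opaque
  F : ℕ → ℕ
  F n = proj₁ (valuation (n !) {{n !≢0}})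

  valuation-F : ∀ n → Valuation (F n) (n !)
  valuation-F n = proj₂ (valuation (n !) {{n !≢0}})

F[0]≡0 : F 0 ≡ 0
F[0]≡0 = valuation-unique (valuation-F 0) (odd-cofactor 0 refl)

F-mono : m ≤ n → F m ≤ F n
F-mono {m} {n} m≤n =
  valuation-∣⇒≤ (valuation-F n)
    (∣-trans (valuation-≤⇒∣ (valuation-F m) ≤-refl) (m≤n⇒m!∣n! m≤n))

odd*odd : ∀ m n → (1 + 2 * m) * (1 + 2 * n) ≡ 1 + 2 * (m + n + 2 * (m * n))
odd*odd = solve-∀

-- The even factors of `(2 * m) !` multiply to `2 ^ m * m !`, and the odd ones to an odd number.
[2*m]! : ∀ m → ∃ λ q → (2 * m) ! ≡ 2 ^ m * (m ! * (1 + 2 * q))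
[2*m]! zero = 0 , refl
[2*m]! (suc m) with [2*m]! m
... | q , eq = m + q + 2 * (m * q) , (begin
  (2 * suc m) !
    ≡⟨ cong _! (*-suc 2 m) ⟩
  (2 + 2 * m) * ((1 + 2 * m) * (2 * m) !)
    ≡⟨ cong (λ x → (2 + 2 * m) * ((1 + 2 * m) * x)) eq ⟩
  (2 + 2 * m) * ((1 + 2 * m) * (2 ^ m * (m ! * (1 + 2 * q))))
    ≡⟨ regroup m q (2 ^ m) (m !) ⟩
  2 ^ suc m * (suc m ! * (1 + 2 * (m + q + 2 * (m * q))))  ∎)
  where
  open ≡-Reasoning
  regroup : ∀ m q x y →
    (2 + 2 * m) * ((1 + 2 * m) * (x * (y * (1 + 2 * q)))) ≡
    2 * x * ((1 + m) * y * (1 + 2 * (m + q + 2 * (m * q))))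
  regroup = solve-∀

opaque
  F-even : ∀ m → F (2 * m) ≡ m + F m
  F-even m with valuation-F m | [2*m]! m
  ... | odd-cofactor q m!≡ | p , eq =
    valuation-unique (valuation-F (2 * m)) (odd-cofactor (q + p + 2 * (q * p)) (begin
      (2 * m) !
        ≡⟨ eq ⟩
      2 ^ m * (m ! * (1 + 2 * p))
        ≡⟨ cong (λ x → 2 ^ m * (x * (1 + 2 * p))) m!≡ ⟩
      2 ^ m * (2 ^ F m * (1 + 2 * q) * (1 + 2 * p))
        ≡⟨ cong (2 ^ m *_) (*-assoc (2 ^ F m) _ _) ⟩
      2 ^ m * (2 ^ F m * ((1 + 2 * q) * (1 + 2 * p)))
        ≡⟨ *-assoc (2 ^ m) (2 ^ F m) _ ⟨
      2 ^ m * 2 ^ F m * ((1 + 2 * q) * (1 + 2 * p))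
        ≡⟨ cong₂ _*_ (sym (^-distribˡ-+-* 2 m (F m))) (odd*odd q p) ⟩
      2 ^ (m + F m) * (1 + 2 * (q + p + 2 * (q * p)))  ∎))
    where open ≡-Reasoning

  F-odd : ∀ m → F (1 + 2 * m) ≡ F (2 * m)
  F-odd m with valuation-F (2 * m)
  ... | odd-cofactor q eq =
    valuation-unique (valuation-F (1 + 2 * m)) (odd-cofactor (m + q + 2 * (m * q)) (begin
      (1 + 2 * m) * (2 * m) !
        ≡⟨ cong ((1 + 2 * m) *_) eq ⟩
      (1 + 2 * m) * (2 ^ F (2 * m) * (1 + 2 * q))
        ≡⟨ regroup m q (2 ^ F (2 * m)) ⟩
      2 ^ F (2 * m) * (1 + 2 * (m + q + 2 * (m * q)))  ∎))
    where
    open ≡-Reasoning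
    regroup : ∀ m q x → (1 + 2 * m) * (x * (1 + 2 * q)) ≡ x * (1 + 2 * (m + q + 2 * (m * q)))
    regroup = solve-∀

E : ℕ → ℕ
E m = F (2 * m)

E-mono-< : m < n → E m < E n
E-mono-< {m} {n} m<n =
  subst₂ _<_ (sym (F-even m)) (sym (F-even n)) (+-mono-<-≤ m<n (F-mono (<⇒≤ m<n)))

E-mono-≤ : m ≤ n → E m ≤ E n
E-mono-≤ m≤n = F-mono (*-monoʳ-≤ 2 m≤n)

-- This jump of exactly one is what prevents an odd value of `T` from repeating.
E-odd : ∀ n → E (1 + 2 * n) ≡ 1 + E (2 * n)
E-odd n = begin
  E (1 + 2 * n)               ≡⟨ F-even (1 + 2 * n) ⟩
  1 + 2 * n + F (1 + 2 * n)   ≡⟨ cong (1 + 2 * n +_) (F-odd n) ⟩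
  1 + (2 * n + F (2 * n))     ≡⟨ cong suc (F-even (2 * n)) ⟨
  1 + E (2 * n)               ∎
  where open ≡-Reasoning

m≤E[m] : ∀ m → m ≤ E m
m≤E[m] m = ≤-trans (m≤m+n m (F m)) (≤-reflexive (sym (F-even m)))

-- The generalised inverse `T` of `E` and its recursion.

-- First k m says that m is T k.
First : ℕ → ℕ → Set
First k = IsLeast (λ m → k ≤ E m)

first : ∀ k → ∃ (First k)
first k = least (λ m → k ≤? E m) k (m≤E[m] k)

first-pred : First k (suc m) → E m < k
first-pred (_ , min) = ≰⇒> λ k≤ → 1+n≰n (min _ k≤)

first⇒≤ : First k m → m ≤ k
first⇒≤ {k} (_ , min) = min k (m≤E[m] k)

-- The largest number below `2 * n` is odd, so `F m` is at most `E (n ∸ 1)`, and `E` is strictly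
-- increasing.
F<E : m < 2 * n → F m < E n
F<E {n = zero} ()
F<E {m} {suc n} m<2n = begin-strict
  F m            ≤⟨ F-mono (m<1+n⇒m≤n (subst (m <_) (*-suc 2 n) m<2n)) ⟩
  F (1 + 2 * n)  ≡⟨ F-odd n ⟩
  E n            <⟨ E-mono-< (n<1+n n) ⟩
  E (suc n)      ∎
  where open ≤-Reasoning

module _ {k m : ℕ} (T : First k m) (n : ℕ) where
  open ≤-Reasoning

  -- In this implication and its converse, both inequalities hold if `m < 2 * n` and both fail if
  -- `m > 2 * n`. If `m = 2 * n`, they differ by a shift by `m`, since `E (2 * n) = 2 * n + E n`.
  arg≤E⇒ : 1 + k ∸ m ≤ E n → 1 + k ≤ E (2 * n)
  arg≤E⇒ h with <-cmp m (2 * n)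
  ... | tri< m<2n _ _ = ≤-<-trans (proj₁ T) (E-mono-< m<2n)
  ... | tri≈ _ refl _ = begin
    1 + k                      ≤⟨ m≤n+m∸n (1 + k) (2 * n) ⟩
    2 * n + (1 + k ∸ 2 * n)    ≤⟨ +-monoʳ-≤ (2 * n) h ⟩
    2 * n + E n                ≡⟨ F-even (2 * n) ⟨
    E (2 * n)                  ∎
  -- Here `m = suc p`, and minimality of `m` gives `E p < k`, which pushes `k ∸ p` above `E n`.
  arg≤E⇒ h | tri> _ _ (s≤s {n = p} 2n≤p) = contradiction (begin-strict
    E n                    <⟨ n<1+n (E n) ⟩
    1 + E n                ≡⟨ m+n∸m≡n p (1 + E n) ⟨
    p + (1 + E n) ∸ p      ≤⟨ ∸-monoˡ-≤ p k≥ ⟩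
    k ∸ p                  ≤⟨ h ⟩
    E n                    ∎) (n≮n (E n))
    where
    k≥ : p + (1 + E n) ≤ k
    k≥ = begin
      p + (1 + E n)  ≡⟨ +-suc p (E n) ⟩
      1 + (p + E n)  ≤⟨ s≤s (+-monoʳ-≤ p (F-mono 2n≤p)) ⟩
      1 + (p + F p)  ≡⟨ cong suc (F-even p) ⟨
      1 + E p        ≤⟨ first-pred T ⟩
      k              ∎

  arg≤E⇐ : 1 + k ≤ E (2 * n) → 1 + k ∸ m ≤ E n
  arg≤E⇐ h with <-cmp m (2 * n)
  ... | tri< m<2n _ _ = m≤n+o⇒m∸n≤o (1 + k) m (begin
    1 + k          ≤⟨ s≤s (proj₁ T) ⟩
    1 + E m        ≡⟨ cong suc (F-even m) ⟩
    1 + (m + F m)  ≡⟨ +-suc m (F m) ⟨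
    m + (1 + F m)  ≤⟨ +-monoʳ-≤ m (F<E {n = n} m<2n) ⟩
    m + E n        ∎)
  ... | tri≈ _ refl _ =
    m≤n+o⇒m∸n≤o (1 + k) m (≤-trans h (≤-reflexive (F-even (2 * n))))
  ... | tri> _ _ 2n<m =
    contradiction (proj₂ T (2 * n) (<⇒≤ h)) (<⇒≱ 2n<m)

-- `1 + k ∸ m ≤ E p` is equivalent to `1 + k ≤ E (2 * p)`, that is, to `n ≤ 2 * p`; the least such
-- `p` is `⌈ n /2⌉`.
first-arg : First k m → First (1 + k) n → First (1 + k ∸ m) ⌈ n /2⌉
first-arg {k} {m} {n} T T′ =
  arg≤E⇐ T ⌈ n /2⌉ (≤-trans (proj₁ T′) (E-mono-≤ (⌈n/2⌉≤m⇒n≤2*m n ≤-refl))) ,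
  λ p h → n≤2*m⇒⌈n/2⌉≤m (proj₂ T′ (2 * p) (arg≤E⇒ T p h))

first-suc : First k m → First (1 + k) n → n ≡ m ⊎ n ≡ 1 + m
first-suc {m = m} (k≤ , min) (k< , min′)
  with m≤n⇒m<n∨m≡n (min′ (1 + m) (≤-<-trans k≤ (E-mono-< (n<1+n m))))
... | inj₂ n≡     = inj₂ n≡
... | inj₁ n<1+m = inj₁ (≤-antisym (m<1+n⇒m≤n n<1+m) (min _ (<⇒≤ k<)))

-- If `m = 1 + 2 * h`, then `E (2 * h) < k`, so `E m = 1 + E (2 * h)` is at most `k` and cannot
-- reach `1 + k`.
first-repeat-even : First k m → First (1 + k) m → ∃ λ h → m ≡ 2 * h
first-repeat-even {m = m} T T′ with parity m
... | h , inj₁ m≡   = h , m≡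
... | h , inj₂ refl =
  contradiction (≤-trans (proj₁ T′) (≤-trans (≤-reflexive (E-odd h)) (first-pred T))) 1+n≰n

⌈/2⌉+⌈/2⌉ : First k m → First (1 + k) n → ⌈ n /2⌉ + ⌈ m /2⌉ ≡ n
⌈/2⌉+⌈/2⌉ {m = m} T T′ with first-suc T T′
-- `⌈ m /2⌉` is `⌊ suc m /2⌋` by definition.
... | inj₂ refl = trans (+-comm ⌈ suc m /2⌉ ⌈ m /2⌉) (⌊n/2⌋+⌈n/2⌉≡n (suc m))
... | inj₁ refl with first-repeat-even T T′
...   | h , refl = begin
  ⌈ 2 * h /2⌉ + ⌈ 2 * h /2⌉  ≡⟨ cong₂ _+_ (⌈2*n/2⌉≡n h) (⌈2*n/2⌉≡n h) ⟩
  h + h                      ≡⟨ cong (h +_) (+-identityʳ h) ⟨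
  2 * h                      ∎
  where open ≡-Reasoning

-- Stated for arbitrary witnesses so that the induction can supply values of `a₂`. Uniqueness of
-- least elements forces `x` and `y` to be the halves, rounded up, of `T (2 + k)` and `n`.
first-rec : ∀ {x y} → First k m → First (1 + k) n →
            First (2 + k ∸ n) x → First (1 + k ∸ m) y → First (2 + k) (x + y)
first-rec {k} {m} {n} T₀ T₁ X Y with first (2 + k)
... | p , T₂ = subst (First (2 + k)) (sym x+y≡p) T₂
  where
  x+y≡p = trans
    (cong₂ _+_ (isLeast-unique X (first-arg T₁ T₂)) (isLeast-unique Y (first-arg T₀ T₁)))
    (⌈/2⌉+⌈/2⌉ T₁ T₂)

-- Identification of `T` with `a₂` and of `2 * T` with `S₂`.

first-positive : First (1 + k) m → 0 < m
first-positive {k} {zero}  (1+k≤ , _) = contradiction (subst (1 + k ≤_) F[0]≡0 1+k≤) λ ()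
first-positive {k} {suc _} _          = s≤s z≤n

a₂-first : ∀ k → First k (a₂ k)
a₂-first = <-rec (λ k → First k (a₂ k)) go
  where
  go : ∀ k → (∀ {j} → j < k → First j (a₂ j)) → First k (a₂ k)
  go zero       _  = z≤n , λ _ _ → z≤n
  go (suc zero) _  = subst (First 1) first-1 (proj₂ (first 1))
    where
    first-1 : proj₁ (first 1) ≡ 1
    first-1 = ≤-antisym (first⇒≤ (proj₂ (first 1))) (first-positive (proj₂ (first 1)))
  go (suc (suc k)) ih =
    subst (First (2 + k)) (sym (a₂-rec k)) (first-rec T₀ T₁ (ih arg₁<) (ih arg₀<))
    where
    T₀ = ih {k} (m≤n+m (1 + k) 1)
    T₁ = ih {1 + k} ≤-refl
    -- The argument drops below `2 + k` because `a₂ (1 + k)` is positive.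
    arg₁< : 2 + k ∸ a₂ (1 + k) < 2 + k
    arg₁< = s≤s (∸-monoʳ-≤ (2 + k) (first-positive T₁))
    arg₀< : 1 + k ∸ a₂ k < 2 + k
    arg₀< = s≤s (m∸n≤m (1 + k) (a₂ k))

-- Passing from `2 * h` to `1 + 2 * h` adds no factor 2 to the factorial, so the least `n` is even;
-- for `n = 2 * h` the condition reads `k ≤ E h`.
first⇒least-factorial : First k m → IsLeast (λ n → 2 ^ k ∣ n !) (2 * m)
first⇒least-factorial {k} {m} (k≤ , min) = valuation-≤⇒∣ (valuation-F (2 * m)) k≤ , min′
  where
  min′ : ∀ n → 2 ^ k ∣ n ! → 2 * m ≤ n
  min′ n 2^k∣n! with valuation-∣⇒≤ {k = k} (valuation-F n) 2^k∣n! | parity n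
  ... | k≤F | h , inj₁ refl = *-monoʳ-≤ 2 (min h k≤F)
  ... | k≤F | h , inj₂ refl =
    m≤n⇒m≤1+n (*-monoʳ-≤ 2 (min h (≤-trans k≤F (≤-reflexive (F-odd h)))))

theorem3p16 : ∀ (k : ℕ) → S₂ k ≡ 2 * a₂ k
theorem3p16 k = isLeast-unique (S₂-isLeast k) (first⇒least-factorial (a₂-first k))
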